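{- Let $k\ge 2$, let $U$ be a finite nonempty set, and let $f:\{0,\ldots,k\}^U\to\mathbb{R}_{+}$ be $k$-submodular. Let $\mathbf{s}$ be the solution produced by the deterministic greedy algorithm on $f$ (for an arbitrary processing order of $U$), and let $\mathbf{o}$ be an optimal solution, i.e. a maximizer of $f$ over $\{0,\ldots,k\}^U$. Then \[f(\mathbf{s})\ \ge\ \tfrac13 f(\mathbf{o}).\]
   Context: $\mathbb{R}_{+}$ denotes the non-negative reals. For $s,t\in\{0,\ldots,k\}$ define $\mathrm{min}_0(s,t)=0$ if $s\neq 0$, $t\neq 0$ and $s\neq t$, and $\mathrm{min}_0(s,t)=\min(s,t)$ otherwise; define $\mathrm{max}_0(s,t)=0$ if $s\neq 0$, $t\neq 0$ and $s\neq t$, and $\mathrm{max}_0(s,t)=\max(s,t)$ otherwise. Both are applied coordinate-wise to vectors. $f$ is $k$-submodular if $f(\mathbf{s})+f(\mathbf{t})\ge f(\mathrm{min}_0(\mathbf{s},\mathbf{t}))+f(\mathrm{max}_0(\mathbf{s},\mathbf{t}))$ for all $\mathbf{s},\mathbf{t}\in\{0,\ldots,k\}^U$. For $e\in U$, $i\in\{1,\ldots,k\}$ and $\mathbf{s}$ with $s_e=0$, let $f_{i,e}(\mathbf{s})=f(\mathbf{s}+i\cdot\mathbf{1}_e)-f(\mathbf{s})$, where $\mathbf{1}_e$ is the unit vector of coordinate $e$. Deterministic greedy algorithm: start with $\mathbf{s}=\mathbf{0}$. Process the elements of $U$ one at a time in an arbitrary order; when processing $e$, compute $y_i=f_{i,e}(\mathbf{s})$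 for $i=1,\ldots,k$ with respect to the current $\mathbf{s}$, let $q$ be the smallest index with $y_q=\max(y_1,\ldots,y_k)$, and permanently set $s_e\gets q$. After all elements have been processed, return $\mathbf{s}$. -}

module Defs where

open import Data.Bool.Base using (if_then_else_)
open import Data.Fin.Base as Fin using (Fin; zero; suc)
import Data.Fin.Properties as Fin
open import Data.List.Base using (List; []; _∷_)
open import Data.Nat.Base as ℕ using (ℕ; suc)
import Data.Nat.Properties as ℕ
open import Data.Product.Base using (∃-syntax; _×_; _,_; proj₁; proj₂)
open import Data.Rational.Base as ℚ using (ℚ; 0ℚ; 1ℚ; ½)
import Data.Rational.Properties as ℚ
open import Data.Rational.Solver using (module +-*-Solver)
open import Data.Vec.Base using (Vec; zipWith; _[_]≔_)
open import Relation.Binary.PropositionalEquality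
  using (_≡_; refl; sym; trans; cong; subst)
open import Relation.Nullary.Decidable using (Dec; does; ¬?; _×-dec_)
open import Relation.Nullary.Negation using (¬_)
import Algebra.Construct.NaturalChoice.Max as Max
import Algebra.Construct.NaturalChoice.Min as Min

------------------------------------------------------------------------
-- Real numbers, as Cauchy sequences of rationals

IsCauchy : (ℕ → ℚ) → Set
IsCauchy a = ∀ ε → 0ℚ ℚ.< ε →
  ∃[ N ] (∀ m n → N ℕ.≤ m → N ℕ.≤ n → ℚ.∣ a m ℚ.- a n ∣ ℚ.≤ ε)

record ℝ : Set where
  constructor mkℝ
  field
    seq    : ℕ → ℚ
    cauchy : IsCauchy seq

open ℝ public

-- Sequences are not quotiented: equality of reals is ≤ in both directions,
-- and x ≤ y only constrains the limits.

infix 4 _≤_ _≥_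

_≤_ : ℝ → ℝ → Set
x ≤ y = ∀ ε → 0ℚ ℚ.< ε → ∃[ N ] (∀ n → N ℕ.≤ n → seq x n ℚ.≤ seq y n ℚ.+ ε)

_≥_ : ℝ → ℝ → Set
x ≥ y = y ≤ x

private
  0<½ε : ∀ {ε} → 0ℚ ℚ.< ε → 0ℚ ℚ.< ½ ℚ.* ε
  0<½ε {ε} 0<ε = subst (ℚ._< ½ ℚ.* ε) (ℚ.*-zeroʳ ½) (ℚ.*-monoʳ-<-pos ½ 0<ε)

  ½ε+½ε≡ε : ∀ ε → ½ ℚ.* ε ℚ.+ ½ ℚ.* ε ≡ ε
  ½ε+½ε≡ε ε = trans (sym (ℚ.*-distribʳ-+ ε ½ ½)) (ℚ.*-identityˡ ε)

  +-interchange : ∀ a b c d → (a ℚ.+ b) ℚ.- (c ℚ.+ d) ≡ (a ℚ.- c) ℚ.+ (b ℚ.- d)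
  +-interchange = solve 4
    (λ a b c d → (a :+ b) :- (c :+ d) := (a :- c) :+ (b :- d)) refl
    where open +-*-Solver

  neg-swap : ∀ a b → (ℚ.- a) ℚ.- (ℚ.- b) ≡ b ℚ.- a
  neg-swap = solve 2 (λ a b → (:- a) :- (:- b) := b :- a) refl
    where open +-*-Solver

  *-distrib-minus : ∀ q a b → q ℚ.* a ℚ.- q ℚ.* b ≡ q ℚ.* (a ℚ.- b)
  *-distrib-minus = solve 3 (λ q a b → q :* a :- q :* b := q :* (a :- b)) refl
    where open +-*-Solver

  const-cauchy : ∀ q → IsCauchy (λ _ → q)
  const-cauchy q ε 0<ε = 0 , λ _ _ _ _ →
    subst (ℚ._≤ ε) (cong ℚ.∣_∣ (sym (ℚ.+-inverseʳ q))) (ℚ.<⇒≤ 0<ε)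

  +-cauchy : ∀ a b → IsCauchy a → IsCauchy b → IsCauchy (λ n → a n ℚ.+ b n)
  +-cauchy a b ca cb ε 0<ε
    with ca (½ ℚ.* ε) (0<½ε 0<ε) | cb (½ ℚ.* ε) (0<½ε 0<ε)
  ... | M , a≤ | N , b≤ = M ℕ.⊔ N , λ m n M⊔N≤m M⊔N≤n → begin
    ℚ.∣ (a m ℚ.+ b m) ℚ.- (a n ℚ.+ b n) ∣
      ≡⟨ cong ℚ.∣_∣ (+-interchange (a m) (b m) (a n) (b n)) ⟩
    ℚ.∣ (a m ℚ.- a n) ℚ.+ (b m ℚ.- b n) ∣
      ≤⟨ ℚ.∣p+q∣≤∣p∣+∣q∣ (a m ℚ.- a n) (b m ℚ.- b n) ⟩
    ℚ.∣ a m ℚ.- a n ∣ ℚ.+ ℚ.∣ b m ℚ.- b n ∣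
      ≤⟨ ℚ.+-mono-≤
           (a≤ m n (ℕ.m⊔n≤o⇒m≤o M N M⊔N≤m) (ℕ.m⊔n≤o⇒m≤o M N M⊔N≤n))
           (b≤ m n (ℕ.m⊔n≤o⇒n≤o M N M⊔N≤m) (ℕ.m⊔n≤o⇒n≤o M N M⊔N≤n)) ⟩
    ½ ℚ.* ε ℚ.+ ½ ℚ.* ε
      ≡⟨ ½ε+½ε≡ε ε ⟩
    ε ∎
    where open ℚ.≤-Reasoning

  neg-cauchy : ∀ a → IsCauchy a → IsCauchy (λ n → ℚ.- a n)
  neg-cauchy a ca ε 0<ε with ca ε 0<ε
  ... | N , a≤ = N , λ m n N≤m N≤n →
    subst (ℚ._≤ ε) (cong ℚ.∣_∣ (sym (neg-swap (a m) (a n)))) (a≤ n m N≤n N≤m)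

  -- The modulus for q • x at ε is that of x at ε / (∣q∣ + 1).
  •-cauchy : ∀ q a → IsCauchy a → IsCauchy (λ n → q ℚ.* a n)
  •-cauchy q a ca ε 0<ε = proj₁ caδ , λ m n N≤m N≤n → begin
    ℚ.∣ q ℚ.* a m ℚ.- q ℚ.* a n ∣
      ≡⟨ cong ℚ.∣_∣ (*-distrib-minus q (a m) (a n)) ⟩
    ℚ.∣ q ℚ.* (a m ℚ.- a n) ∣
      ≡⟨ ℚ.∣p*q∣≡∣p∣*∣q∣ q (a m ℚ.- a n) ⟩
    ℚ.∣ q ∣ ℚ.* ℚ.∣ a m ℚ.- a n ∣
      ≤⟨ ℚ.*-monoʳ-≤-nonNeg ℚ.∣ a m ℚ.- a n ∣
           {{ℚ.nonNegative (ℚ.0≤∣p∣ (a m ℚ.- a n))}} ∣q∣≤c ⟩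
    c ℚ.* ℚ.∣ a m ℚ.- a n ∣
      ≤⟨ ℚ.*-monoˡ-≤-nonNeg c {{ℚ.nonNegative (ℚ.<⇒≤ 0<c)}}
           (proj₂ caδ m n N≤m N≤n) ⟩
    c ℚ.* (1/c ℚ.* ε)
      ≡⟨ sym (ℚ.*-assoc c 1/c ε) ⟩
    (c ℚ.* 1/c) ℚ.* ε
      ≡⟨ cong (ℚ._* ε) (ℚ.*-inverseʳ c {{c≢0}}) ⟩
    1ℚ ℚ.* ε
      ≡⟨ ℚ.*-identityˡ ε ⟩
    ε ∎
    where
    open ℚ.≤-Reasoning
    c : ℚ
    c = ℚ.∣ q ∣ ℚ.+ 1ℚ
    0<c : 0ℚ ℚ.< c
    0<c = ℚ.+-mono-≤-< (ℚ.0≤∣p∣ q) (ℚ.positive⁻¹ 1ℚ)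
    ∣q∣≤c : ℚ.∣ q ∣ ℚ.≤ c
    ∣q∣≤c = subst (ℚ._≤ c) (ℚ.+-identityʳ ℚ.∣ q ∣)
              (ℚ.+-monoʳ-≤ ℚ.∣ q ∣ (ℚ.nonNegative⁻¹ 1ℚ))
    c≢0 : ℚ.NonZero c
    c≢0 = ℚ.pos⇒nonZero c {{ℚ.positive 0<c}}
    1/c : ℚ
    1/c = ℚ.1/_ c {{c≢0}}
    0<1/c : 0ℚ ℚ.< 1/c
    0<1/c = ℚ.positive⁻¹ 1/c {{ℚ.1/pos⇒pos c {{ℚ.positive 0<c}}}}
    0<δ : 0ℚ ℚ.< 1/c ℚ.* ε
    0<δ = subst (ℚ._< 1/c ℚ.* ε) (ℚ.*-zeroʳ 1/c)
            (ℚ.*-monoʳ-<-pos 1/c {{ℚ.positive 0<1/c}} 0<ε)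
    caδ = ca (1/c ℚ.* ε) 0<δ

infixl 6 _+_ _-_
infixr 7 _•_

0ℝ : ℝ
0ℝ = mkℝ (λ _ → 0ℚ) (const-cauchy 0ℚ)

_+_ : ℝ → ℝ → ℝ
x + y = mkℝ (λ n → seq x n ℚ.+ seq y n)
            (+-cauchy (seq x) (seq y) (cauchy x) (cauchy y))

_-_ : ℝ → ℝ → ℝ
x - y = mkℝ (λ n → seq x n ℚ.- seq y n)
            (+-cauchy (seq x) (λ n → ℚ.- seq y n)
                      (cauchy x) (neg-cauchy (seq y) (cauchy y)))

_•_ : ℚ → ℝ → ℝ
q • x = mkℝ (λ n → q ℚ.* seq x n) (•-cauchy q (seq x) (cauchy x))

------------------------------------------------------------------------
-- k-submodular functions

-- {0,…,k}^U with U = Fin n.  Vectors rather than functions Fin n → Fin (suc k),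
-- so that pointwise equal labellings are propositionally equal.
Labelling : ℕ → ℕ → Set
Labelling k n = Vec (Fin (suc k)) n

Conflict : ∀ {k} → Fin (suc k) → Fin (suc k) → Set
Conflict s t = ¬ (s ≡ zero) × ¬ (t ≡ zero) × ¬ (s ≡ t)

conflict? : ∀ {k} (s t : Fin (suc k)) → Dec (Conflict s t)
conflict? s t = ¬? (s Fin.≟ zero) ×-dec ¬? (t Fin.≟ zero) ×-dec ¬? (s Fin.≟ t)

min₀ : ∀ {k} → Fin (suc k) → Fin (suc k) → Fin (suc k)
min₀ {k} s t = if does (conflict? s t) then zero else s ⊓ t
  where open Min (Fin.≤-totalOrder (suc k)) using (_⊓_)

max₀ : ∀ {k} → Fin (suc k) → Fin (suc k) → Fin (suc k)
max₀ {k} s t = if does (conflict? s t) then zero else s ⊔ t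
  where open Max (Fin.≤-totalOrder (suc k)) using (_⊔_)

KSubmodular : ∀ {k n} → (Labelling k n → ℝ) → Set
KSubmodular f = ∀ s t → f s + f t ≥ f (zipWith min₀ s t) + f (zipWith max₀ s t)

IsMaximizer : ∀ {k n} → (Labelling k n → ℝ) → Labelling k n → Set
IsMaximizer f o = ∀ t → f t ≤ f o

------------------------------------------------------------------------
-- The deterministic greedy algorithm

-- The non-zero labels 1,…,k are suc i for i : Fin k.  When s_e = 0, the
-- labelling s + i·1_e is s with coordinate e overwritten by i.
marginal : ∀ {k n} → (Labelling k n → ℝ) → Fin k → Fin n → Labelling k n → ℝ
marginal f i e s = f (s [ e ]≔ suc i) - f s

IsArgmax : ∀ {k} → (Fin k → ℝ) → Fin k → Set
IsArgmax y q = ∀ i → y i ≤ y q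

IsLeastArgmax : ∀ {k} → (Fin k → ℝ) → Fin k → Set
IsLeastArgmax y q = IsArgmax y q × (∀ j → j Fin.< q → ¬ IsArgmax y j)

-- GreedyRun f s es t: processing the elements es in order, starting from s,
-- ends in t.  This is a relation because the order on ℝ is not decidable, so
-- the least maximizing index cannot be computed.
data GreedyRun {k n} (f : Labelling k n → ℝ) :
               Labelling k n → List (Fin n) → Labelling k n → Set where
  done : ∀ {s} → GreedyRun f s [] s
  step : ∀ {s t e es} q → IsLeastArgmax (λ i → marginal f i e s) q →
         GreedyRun f (s [ e ]≔ suc q) es t → GreedyRun f s (e ∷ es) t

-- Follow the run together with the labelling t that agrees with the current
-- partial solution s on the processed elements and with the optimum o on the
-- others, so that s ⪯ t throughout.  Processing e changes t only at e, and
-- orthant submodularity together with pairwise monotonicity bounds the loss in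
-- f t by twice the gain in f s, which is the largest marginal at s.
-- Telescoping from s = 0, t = o to the common final labelling u gives
-- f o - f u ≤ 2 (f u - f 0), hence f o ≤ 3 f u.
module Submission where

open import Defs
open import Data.Fin.Base using (Fin; zero; suc)
open import Data.Fin.Properties using (_≟_; ≤-totalOrder; suc-injective)
open import Data.Integer.Base using (+_)
open import Data.List.Base using (List; []; _∷_; allFin)
open import Data.List.Membership.Propositional using (_∈_)
open import Data.List.Membership.Propositional.Properties using (∈-allFin)
open import Data.List.Relation.Binary.Permutation.Propositional
  using (_↭_; ↭-sym; ↭⇒↭ₛ)
open import Data.List.Relation.Binary.Permutation.Propositional.Properties
  using (∈-resp-↭)
open import Data.List.Relation.Binary.Permutation.Setoid.Properties
  using (Unique-resp-↭)
open import Data.List.Relation.Unary.All as All using (All; _∷_)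
open import Data.List.Relation.Unary.Any using (here; there)
open import Data.List.Relation.Unary.AllPairs using (_∷_)
open import Data.List.Relation.Unary.Unique.Propositional using (Unique)
open import Data.List.Relation.Unary.Unique.Propositional.Properties
  using (allFin⁺)
open import Data.Nat.Base as ℕ using (ℕ; s≤s)
import Data.Nat.Properties as ℕ
open import Data.Product.Base using (∃-syntax; _,_)
open import Data.Rational.Base as ℚ using (ℚ; 0ℚ; ½; _/_)
import Data.Rational.Properties as ℚ
open import Data.Rational.Solver using (module +-*-Solver)
open import Data.Sum.Base using (_⊎_; inj₁; inj₂)
open import Data.Vec.Base
  using (Vec; []; _∷_; lookup; replicate; zipWith; _[_]≔_)
open import Data.Vec.Properties
  using ([]≔-lookup; lookup∘update; lookup∘update′; lookup-replicate)
open import Data.Vec.Relation.Binary.Pointwise.Extensional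
  using (ext; extensional⇒inductive) renaming (Pointwise-≡⇒≡ to ext⇒≡)
open import Data.Vec.Relation.Binary.Pointwise.Inductive as Pointwise
  using (Pointwise; []; _∷_)
open import Function.Base using (_∘_; case_of_)
open import Relation.Binary.PropositionalEquality
open import Relation.Nullary.Decidable using (yes; no; dec-true; dec-false)
import Algebra.Construct.NaturalChoice.Max as Max
import Algebra.Construct.NaturalChoice.Min as Min

open +-*-Solver using (solve; con; _:+_; _:*_; _:-_; _:=_)

-- Linear arithmetic in ℝ

-- Every linear consequence is drawn by summing hypotheses and rearranging the
-- sum, the rearrangement being a ring identity between the sequences.
≤-resp-gap : ∀ x y x′ y′ →
  (∀ n → seq y n ℚ.- seq x n ≡ seq y′ n ℚ.- seq x′ n) → x ≤ y → x′ ≤ y′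
≤-resp-gap x y x′ y′ gap x≤y ε 0<ε with x≤y ε 0<ε
... | N , h = N , λ n N≤n → begin
  seq x′ n
    ≡⟨ solve 2 (λ a b → b := (b :- a) :+ a) refl (seq x n) (seq x′ n) ⟩
  (seq x′ n ℚ.- seq x n) ℚ.+ seq x n
    ≤⟨ ℚ.+-monoʳ-≤ (seq x′ n ℚ.- seq x n) (h n N≤n) ⟩
  (seq x′ n ℚ.- seq x n) ℚ.+ (seq y n ℚ.+ ε)
    ≡⟨ solve 4 (λ a b c d → (b :- a) :+ (c :+ d) := (c :- a) :+ (b :+ d)) refl
         (seq x n) (seq x′ n) (seq y n) ε ⟩
  (seq y n ℚ.- seq x n) ℚ.+ (seq x′ n ℚ.+ ε)
    ≡⟨ cong (ℚ._+ (seq x′ n ℚ.+ ε)) (gap n) ⟩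
  (seq y′ n ℚ.- seq x′ n) ℚ.+ (seq x′ n ℚ.+ ε)
    ≡⟨ solve 3 (λ b c d → (c :- b) :+ (b :+ d) := c :+ d) refl
         (seq x′ n) (seq y′ n) ε ⟩
  seq y′ n ℚ.+ ε ∎
  where open ℚ.≤-Reasoning

+-mono-≤ : ∀ x y z w → x ≤ y → z ≤ w → x + z ≤ y + w
+-mono-≤ x y z w x≤y z≤w ε 0<ε with x≤y (½ ℚ.* ε) 0<½ε | z≤w (½ ℚ.* ε) 0<½ε
  where
  0<½ε : 0ℚ ℚ.< ½ ℚ.* ε
  0<½ε = subst (ℚ._< ½ ℚ.* ε) (ℚ.*-zeroʳ ½) (ℚ.*-monoʳ-<-pos ½ 0<ε)
... | M , h | N , h′ = M ℕ.⊔ N , λ n M⊔N≤n → begin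
  seq x n ℚ.+ seq z n
    ≤⟨ ℚ.+-mono-≤ (h n (ℕ.m⊔n≤o⇒m≤o M N M⊔N≤n)) (h′ n (ℕ.m⊔n≤o⇒n≤o M N M⊔N≤n)) ⟩
  (seq y n ℚ.+ ½ ℚ.* ε) ℚ.+ (seq w n ℚ.+ ½ ℚ.* ε)
    ≡⟨ solve 3 (λ a b c → (a :+ con ½ :* c) :+ (b :+ con ½ :* c) := (a :+ b) :+ c)
         refl (seq y n) (seq w n) ε ⟩
  (seq y n ℚ.+ seq w n) ℚ.+ ε ∎
  where open ℚ.≤-Reasoning

≤-reflexive : ∀ x y → (∀ n → seq x n ≡ seq y n) → x ≤ y
≤-reflexive x y x≡y ε 0<ε = 0 , λ n _ → begin
  seq x n          ≡⟨ x≡y n ⟩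
  seq y n          ≡⟨ ℚ.+-identityʳ (seq y n) ⟨
  seq y n ℚ.+ 0ℚ   ≤⟨ ℚ.+-monoʳ-≤ (seq y n) (ℚ.<⇒≤ 0<ε) ⟩
  seq y n ℚ.+ ε    ∎
  where open ℚ.≤-Reasoning

≤-trans : ∀ x y z → x ≤ y → y ≤ z → x ≤ z
≤-trans x y z x≤y y≤z = ≤-resp-gap (x + y) (y + z) x z
  (λ n → solve 3 (λ a b c → (b :+ c) :- (a :+ b) := c :- a) refl
    (seq x n) (seq y n) (seq z n))
  (+-mono-≤ x y y z x≤y y≤z)

•-cancelˡ-≤ : ∀ q .{{_ : ℚ.Positive q}} x y → q • x ≤ q • y → x ≤ y
•-cancelˡ-≤ q x y qx≤qy ε 0<ε with qx≤qy (q ℚ.* ε)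
  (subst (ℚ._< q ℚ.* ε) (ℚ.*-zeroʳ q) (ℚ.*-monoʳ-<-pos q 0<ε))
... | N , h = N , λ n N≤n → ℚ.*-cancelˡ-≤-pos q
  (subst (q ℚ.* seq x n ℚ.≤_) (sym (ℚ.*-distribˡ-+ q (seq y n) ε)) (h n N≤n))

-- Submodularity on comparable labellings

infix 4 _⊑_ _⪯_

-- The order with `zero` at the bottom and distinct non-zero labels incomparable. Related labels
-- never conflict, so on them `min₀` and `max₀` act as meet and join.
_⊑_ : ∀ {k} → Fin (ℕ.suc k) → Fin (ℕ.suc k) → Set
x ⊑ y = x ≡ zero ⊎ x ≡ y

_⪯_ : ∀ {k n} → Labelling k n → Labelling k n → Set
_⪯_ = Pointwise _⊑_

min₀-idem : ∀ {k} (x : Fin (ℕ.suc k)) → min₀ x x ≡ x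
min₀-idem {k} x
  rewrite dec-false (conflict? x x) (λ (_ , _ , x≢x) → x≢x refl)
  = Min.⊓-idem (≤-totalOrder (ℕ.suc k)) x

max₀-idem : ∀ {k} (x : Fin (ℕ.suc k)) → max₀ x x ≡ x
max₀-idem {k} x
  rewrite dec-false (conflict? x x) (λ (_ , _ , x≢x) → x≢x refl)
  = Max.⊔-idem (≤-totalOrder (ℕ.suc k)) x

min₀-conflict : ∀ {k} {x y : Fin (ℕ.suc k)} → Conflict x y → min₀ x y ≡ zero
min₀-conflict {x = x} {y} c rewrite dec-true (conflict? x y) c = refl

max₀-conflict : ∀ {k} {x y : Fin (ℕ.suc k)} → Conflict x y → max₀ x y ≡ zero
max₀-conflict {x = x} {y} c rewrite dec-true (conflict? x y) c = refl

⊑⇒min₀≡ : ∀ {k} {x y : Fin (ℕ.suc k)} → x ⊑ y → min₀ x y ≡ x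
⊑⇒min₀≡ {y = zero}  (inj₁ refl) = refl
⊑⇒min₀≡ {y = suc _} (inj₁ refl) = refl
⊑⇒min₀≡ {x = x}     (inj₂ refl) = min₀-idem x

⊑⇒max₀≡ : ∀ {k} {x y : Fin (ℕ.suc k)} → x ⊑ y → max₀ x y ≡ y
⊑⇒max₀≡ {y = zero}  (inj₁ refl) = refl
⊑⇒max₀≡ {y = suc _} (inj₁ refl) = refl
⊑⇒max₀≡ {x = x}     (inj₂ refl) = max₀-idem x

zipWith-min₀ : ∀ {k n} {s t : Labelling k n} → s ⪯ t → zipWith min₀ s t ≡ s
zipWith-min₀ []         = refl
zipWith-min₀ (x⊑y ∷ s⪯t) = cong₂ _∷_ (⊑⇒min₀≡ x⊑y) (zipWith-min₀ s⪯t)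

zipWith-max₀ : ∀ {k n} {s t : Labelling k n} → s ⪯ t → zipWith max₀ s t ≡ t
zipWith-max₀ []         = refl
zipWith-max₀ (x⊑y ∷ s⪯t) = cong₂ _∷_ (⊑⇒max₀≡ x⊑y) (zipWith-max₀ s⪯t)

zipWith-[]≔ : ∀ {A B C : Set} (g : A → B → C) {n} (xs : Vec A n) (ys : Vec B n) e {x y} →
  zipWith g (xs [ e ]≔ x) (ys [ e ]≔ y) ≡ zipWith g xs ys [ e ]≔ g x y
zipWith-[]≔ g (_ ∷ _)  (_ ∷ _)  zero    = refl
zipWith-[]≔ g (x ∷ xs) (y ∷ ys) (suc e) = cong (g x y ∷_) (zipWith-[]≔ g xs ys e)

-- On a comparable pair `min₀` and `max₀` give the pair back, so once coordinate `e` is overwritten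
-- in both, the two operations change labels at `e` alone.
submodular-[]≔ : ∀ {k n} (f : Labelling k n → ℝ) → KSubmodular f →
  ∀ {s t} → s ⪯ t → ∀ e x y →
  f (s [ e ]≔ min₀ x y) + f (t [ e ]≔ max₀ x y) ≤ f (s [ e ]≔ x) + f (t [ e ]≔ y)
submodular-[]≔ f sub {s} {t} s⪯t e x y =
  subst₂ (λ a b → f a + f b ≤ f (s [ e ]≔ x) + f (t [ e ]≔ y))
    (trans (zipWith-[]≔ min₀ s t e) (cong (_[ e ]≔ min₀ x y) (zipWith-min₀ s⪯t)))
    (trans (zipWith-[]≔ max₀ s t e) (cong (_[ e ]≔ max₀ x y) (zipWith-max₀ s⪯t)))
    (sub (s [ e ]≔ x) (t [ e ]≔ y))

-- Diminishing returns at a cleared coordinate `e`. Since `suc i` and `zero` do not conflict, `min₀`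
-- and `max₀` swap them between the two labellings, which holds by computation.
orthant-submodular : ∀ {k n} (f : Labelling k n → ℝ) → KSubmodular f →
  ∀ {s t} → s ⪯ t → ∀ e i →
  f (s [ e ]≔ zero) + f (t [ e ]≔ suc i) ≤ f (s [ e ]≔ suc i) + f (t [ e ]≔ zero)
orthant-submodular f sub s⪯t e i = submodular-[]≔ f sub s⪯t e (suc i) zero

-- Here both labellings are `t`: distinct non-zero labels conflict, so both operations reset `e` to
-- `zero`. Hence two different marginals at `e` have a nonnegative sum.
pairwise-monotone : ∀ {k n} (f : Labelling k n → ℝ) → KSubmodular f →
  ∀ t e {i j} → i ≢ j →
  f (t [ e ]≔ zero) + f (t [ e ]≔ zero) ≤ f (t [ e ]≔ suc i) + f (t [ e ]≔ suc j)
pairwise-monotone f sub t e {i} {j} i≢j =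
  subst₂ (λ a b → f (t [ e ]≔ a) + f (t [ e ]≔ b) ≤ f (t [ e ]≔ suc i) + f (t [ e ]≔ suc j))
    (min₀-conflict conflict) (max₀-conflict conflict)
    (submodular-[]≔ f sub (Pointwise.refl (inj₂ refl)) e (suc i) (suc j))
  where
  conflict : Conflict (suc i) (suc j)
  conflict = (λ ()) , (λ ()) , i≢j ∘ suc-injective

-- One greedy step

other-label : ∀ {k} → 2 ℕ.≤ k → (q : Fin k) → ∃[ j ] j ≢ q
other-label (s≤s (s≤s _)) zero    = suc zero , λ ()
other-label (s≤s (s≤s _)) (suc _) = zero , λ ()

-- For `p` the label of `t` at `e`, the change from `p` to `suc q` is split through `zero`: clearing
-- `p` costs at most one gain `G - S` by `marginal-bound`, and placing `suc q` at most another by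
-- `loss-bound`. If `p` is `zero` or `suc q`, fewer costs arise and nonnegativity of the gain makes
-- up the difference.
greedy-step : ∀ {k n} → 2 ℕ.≤ k → (f : Labelling k n → ℝ) → KSubmodular f →
  ∀ {s t} e q → s ⪯ t → lookup s e ≡ zero →
  IsArgmax (λ i → marginal f i e s) q →
  f t + (f s + f s) ≤
  f (t [ e ]≔ suc q) + (f (s [ e ]≔ suc q) + f (s [ e ]≔ suc q))
greedy-step {k} 2≤k f sub {s} {t} e q s⪯t sₑ≡0 argmax =
  -- Writing the label of `t` at `e` back into `t` puts the goal in terms of `F`, so it can be
  -- proved by cases on that label.
  subst (λ u → f u + (S + S) ≤ F (suc q) + (G + G)) ([]≔-lookup t e) (bound (lookup t e))
  where
  F : Fin (ℕ.suc k) → ℝ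
  F x = f (t [ e ]≔ x)

  S G : ℝ
  S = f s
  G = f (s [ e ]≔ suc q)

  s[e]≔0≡s : s [ e ]≔ zero ≡ s
  s[e]≔0≡s = trans (cong (s [ e ]≔_) (sym sₑ≡0)) ([]≔-lookup s e)

  -- Orthant submodularity carries the marginal of `i` from `t` down to `s`, where `q` has the
  -- largest one.
  marginal-bound : ∀ i → S + F (suc i) ≤ G + F zero
  marginal-bound i = ≤-resp-gap
    ((S + F (suc i)) + (A - S)) ((A + F zero) + (G - S)) (S + F (suc i)) (G + F zero)
    (λ n → solve 5 (λ s g a z x →
      ((a :+ z) :+ (g :- s)) :- ((s :+ x) :+ (a :- s)) := (g :+ z) :- (s :+ x)) refl
      (seq S n) (seq G n) (seq A n) (seq (F zero) n) (seq (F (suc i)) n))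
    (+-mono-≤ (S + F (suc i)) (A + F zero) (A - S) (G - S)
      (subst (λ u → f u + F (suc i) ≤ A + F zero) s[e]≔0≡s
        (orthant-submodular f sub s⪯t e i))
      (argmax i))
    where
    A : ℝ
    A = f (s [ e ]≔ suc i)

  -- For i ≢ q this bounds -f_{q,e}, and not only f_{i,e}, at t by the gain at s.
  loss-bound : ∀ {i} → i ≢ q → S + F zero ≤ G + F (suc q)
  loss-bound {i} i≢q = ≤-resp-gap
    ((S + F (suc i)) + (F zero + F zero)) ((G + F zero) + (F (suc i) + F (suc q)))
    (S + F zero) (G + F (suc q))
    (λ n → solve 5 (λ s g z x y →
      ((g :+ z) :+ (x :+ y)) :- ((s :+ x) :+ (z :+ z)) := (g :+ y) :- (s :+ z)) refl
      (seq S n) (seq G n) (seq (F zero) n) (seq (F (suc i)) n) (seq (F (suc q)) n))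
    (+-mono-≤ (S + F (suc i)) (G + F zero)
      (F zero + F zero) (F (suc i) + F (suc q))
      (marginal-bound i) (pairwise-monotone f sub t e i≢q))

  -- The gain at `s` bounds both the marginal of `q` at `t` and its negative; adding the two bounds
  -- cancels that marginal. The label `j` different from `q` exists because `2 ≤ k`.
  two-gains : S + S ≤ G + G
  two-gains with other-label 2≤k q
  ... | j , j≢q = ≤-resp-gap
    ((S + F (suc q)) + (S + F zero)) ((G + F zero) + (G + F (suc q)))
    (S + S) (G + G)
    (λ n → solve 4 (λ s g z y →
      ((g :+ z) :+ (g :+ y)) :- ((s :+ y) :+ (s :+ z)) := (g :+ g) :- (s :+ s)) refl
      (seq S n) (seq G n) (seq (F zero) n) (seq (F (suc q)) n))
    (+-mono-≤ (S + F (suc q)) (G + F zero) (S + F zero) (G + F (suc q))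
      (marginal-bound q) (loss-bound j≢q))

  gain-nonneg : S ≤ G
  gain-nonneg = •-cancelˡ-≤ two S G (≤-resp-gap (S + S) (G + G) (two • S) (two • G)
    (λ n → solve 2 (λ s g → (g :+ g) :- (s :+ s) := con two :* g :- con two :* s) refl
      (seq S n) (seq G n))
    two-gains)
    where
    two : ℚ
    two = + 2 / 1

  bound : ∀ p → F p + (S + S) ≤ F (suc q) + (G + G)
  bound zero with other-label 2≤k q
  ... | j , j≢q = ≤-resp-gap
    ((S + F zero) + S) ((G + F (suc q)) + G) (F zero + (S + S)) (F (suc q) + (G + G))
    (λ n → solve 4 (λ s g z y →
      ((g :+ y) :+ g) :- ((s :+ z) :+ s) := (y :+ (g :+ g)) :- (z :+ (s :+ s))) refl
      (seq S n) (seq G n) (seq (F zero) n) (seq (F (suc q)) n))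
    (+-mono-≤ (S + F zero) (G + F (suc q)) S G (loss-bound j≢q) gain-nonneg)
  bound (suc i) with i ≟ q
  ... | yes refl = +-mono-≤ (F (suc q)) (F (suc q)) (S + S) (G + G)
    (≤-reflexive (F (suc q)) (F (suc q)) (λ _ → refl)) two-gains
  ... | no i≢q = ≤-resp-gap
    ((S + F (suc i)) + (S + F zero)) ((G + F zero) + (G + F (suc q)))
    (F (suc i) + (S + S)) (F (suc q) + (G + G))
    (λ n → solve 5 (λ s g z x y →
      ((g :+ z) :+ (g :+ y)) :- ((s :+ x) :+ (s :+ z))
        := (y :+ (g :+ g)) :- (x :+ (s :+ s))) refl
      (seq S n) (seq G n) (seq (F zero) n) (seq (F (suc i)) n) (seq (F (suc q)) n))
    (+-mono-≤ (S + F (suc i)) (G + F zero) (S + F zero) (G + F (suc q))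
      (marginal-bound i) (loss-bound i≢q))

-- Telescoping over the run

-- Induction over the run: each step can only increase `f t + (f s + f s)`. The invariant is that a
-- coordinate is either pending, hence `zero` in `s`, or already equal in `s` and `t`; this yields
-- `s ⪯ t` at every step.
greedy-run : ∀ {k n} → 2 ℕ.≤ k → (f : Labelling k n → ℝ) → KSubmodular f →
  ∀ {s es u} → GreedyRun f s es u →
  ∀ t → Unique es → All (λ i → lookup s i ≡ zero) es →
  (∀ i → i ∈ es ⊎ lookup s i ≡ lookup t i) →
  f t + (f s + f s) ≤ f u + (f u + f u)
greedy-run 2≤k f sub {s} done t _ _ agree
  -- With nothing pending, `agree` leaves only equality, so `t` is the final labelling.
  with refl ← ext⇒≡ {xs = s} {ys = t} (ext λ i → case agree i of λ { (inj₂ eq) → eq })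
  = ≤-reflexive (f s + (f s + f s)) (f s + (f s + f s)) (λ _ → refl)
greedy-run 2≤k f sub {s} {e ∷ es} {u} (step q (argmax , _) run) t
           (e∉es ∷ unique) zeros@(sₑ≡0 ∷ zeros′) agree =
  ≤-trans (f t + (f s + f s)) (f t′ + (f s′ + f s′)) (f u + (f u + f u))
    (greedy-step 2≤k f sub e q s⪯t sₑ≡0 argmax)
    (greedy-run 2≤k f sub run t′ unique still-zero agree′)
  where
  s′ = s [ e ]≔ suc q
  t′ = t [ e ]≔ suc q

  below : ∀ i → i ∈ e ∷ es ⊎ lookup s i ≡ lookup t i → lookup s i ⊑ lookup t i
  below i (inj₁ i∈es) = inj₁ (All.lookup zeros i∈es)
  below i (inj₂ eq)   = inj₂ eq

  s⪯t : s ⪯ t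
  s⪯t = extensional⇒inductive (ext λ i → below i (agree i))

  still-zero : All (λ i → lookup s′ i ≡ zero) es
  -- Uniqueness of the pending elements gives `e ≢ i`, so setting `e` leaves the later ones at
  -- `zero`.
  still-zero = All.zipWith
    (λ (e≢i , sᵢ≡0) → trans (lookup∘update′ (e≢i ∘ sym) s (suc q)) sᵢ≡0)
    (e∉es , zeros′)

  agree′ : ∀ i → i ∈ es ⊎ lookup s′ i ≡ lookup t′ i
  agree′ i with i ≟ e | agree i
  ... | yes refl | _ =
    inj₂ (trans (lookup∘update e s (suc q)) (sym (lookup∘update e t (suc q))))
  ... | no i≢e | inj₁ (here i≡e)   with () ← i≢e i≡e
  ... | no i≢e | inj₁ (there i∈es) = inj₁ i∈es
  ... | no i≢e | inj₂ sᵢ≡tᵢ = inj₂ (trans (lookup∘update′ i≢e s (suc q))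
    (trans sᵢ≡tᵢ (sym (lookup∘update′ i≢e t (suc q)))))

corollary17 : (k n : ℕ) → 2 ℕ.≤ k → 1 ℕ.≤ n →
    (f : Labelling k n → ℝ) → (∀ s → 0ℝ ≤ f s) → KSubmodular f →
    (order : List (Fin n)) → order ↭ allFin n →
    (s : Labelling k n) → GreedyRun f (replicate n zero) order s →
    (o : Labelling k n) → IsMaximizer f o →
    f s ≥ (+ 1 / 3) • f o
corollary17 k n 2≤k _ f 0≤f sub order order↭ s run o _ =
  -- The run gives `O + (Z + Z) ≤ S + (S + S)`; adding `0 ≤ Z` twice cancels the starting value.
  -- Scaling the goal by `three` clears the fraction.
  •-cancelˡ-≤ three ((+ 1 / 3) • O) S (≤-resp-gap
    ((O + (Z + Z)) + (0ℝ + 0ℝ)) ((S + (S + S)) + (Z + Z))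
    (three • (+ 1 / 3) • O) (three • S)
    (λ m → solve 3 (λ o z s →
      ((s :+ (s :+ s)) :+ (z :+ z)) :- ((o :+ (z :+ z)) :+ (con 0ℚ :+ con 0ℚ))
        := con three :* s :- con three :* (con (+ 1 / 3) :* o)) refl
      (seq O m) (seq Z m) (seq S m))
    (+-mono-≤ (O + (Z + Z)) (S + (S + S)) (0ℝ + 0ℝ) (Z + Z)
      (greedy-run 2≤k f sub run o
        (Unique-resp-↭ (setoid (Fin n)) (↭⇒↭ₛ (↭-sym order↭)) (allFin⁺ n))
        (All.tabulate (λ {i} _ → lookup-replicate i zero))
        -- Initially every coordinate is pending, since `order` permutes all of `Fin n`.
        (λ i → inj₁ (∈-resp-↭ (↭-sym order↭) (∈-allFin i))))
      (+-mono-≤ 0ℝ Z 0ℝ Z (0≤f _) (0≤f _))))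
  where
  three : ℚ
  three = + 3 / 1

  O S Z : ℝ
  O = f o
  S = f s
  Z = f (replicate n zero)
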